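{- Let $\mathsf{C2.FSM}$ be $\mathsf{C2.FS}$ plus the McKinsey axiom schema $\Box\Diamond p\to\Diamond\Box p$. Then $\mathsf{C2.FSM}$ is sound and weakly complete with respect to list models: for every $p\in\mathcal{L}_>$, $\vdash_{\mathsf{C2.FSM}}p$ if and only if $p$ is true at every element of every list model.
   Context: Language. Let $At=\{p_0,p_1,\ldots\}$ be a countably infinite set of atoms. $\mathcal{L}_>$ is generated by $p ::= p_k\in At\mid \neg p\mid (p\wedge p)\mid (p>p)$; $\vee,\to,\leftrightarrow$ are defined as usual; $\Box p$ abbreviates $\neg p>p$, and $\Diamond p$ abbreviates $\neg\Box\neg p$. Logics. $\mathsf{C2}$ is the smallest set of $\mathcal{L}_>$-sentences containing all instances of: (PC) every (substitution instance of a) theorem of classical propositional logic; (Identity) $p>p$; (Reciprocity) $(p>q)\wedge(q>p)\wedge(p>r)\to(q>r)$; (MP) $(p>q)\to(p\to q)$; (CEM) $(p>q)\vee(p>\neg q)$; and closed under (Detachment) from $\vdash p\to q$ and $\vdash p$ infer $\vdash q$; (Normality) from $\vdash(p\wedge q)\to r$ infer $\vdash((s>p)\wedge(s>q))\to(s>r)$. $\mathsf{C2.FS}$ is the smallest extension of $\mathsf{C2}$ closed under Detachment and Normality and containing every instance of (Flattening) $(p>((p\wedge q)>r))\leftrightarrow((p\wedge q)>r)$ and of (Sequentiality) $\Box(p\to(\neg p>r))\wedge\Box(q\to(\neg q>r))\to((p\vee q)\to(\neg(p\vee q)>r))$. Adding a schema to a logic means taking the smallest extension containing every instance of the schema and closed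 under Detachment and Normality. Order frames and models. An order frame is a pair $\langle W,<\rangle$ where $W\neq\varnothing$ and $<$ is a function taking each $w\in W$ to a strict well-order $<_w$ on some subset of $W$ such that whenever $x<_w y$, either $w=x$ or $w<_w x$. Put $R(w)=\{w\}\cup\{v: w<_w v\}$. An order model $\langle W,<,V\rangle$ adds a valuation $V:At\times W\to\{0,1\}$; put $V(p_k)=\{w:V(p_k,w)=1\}$. Denotations: $[\![p_k]\!]=V(p_k)$, $[\![\neg p]\!]=W\setminus[\![p]\!]$, $[\![p\wedge q]\!]=[\![p]\!]\cap[\![q]\!]$, and $w\in[\![p>q]\!]$ iff either $R(w)\cap[\![p]\!]=\varnothing$, or there is $y\in R(w)\cap[\![p]\!]\cap[\![q]\!]$ such that $x\notin[\![p]\!]$ whenever $x<_w y$. A sentence $p$ is true at $w$ iff $w\in[\![p]\!]$. Lists. A list over a non-empty set $P$ is a function $\sigma:n\to P$ with $n$ a finite ordinal. For $k\le n$ its $k$th tail $\sigma^{[k:]}$ is the list of length $n-k$ with $\sigma^{[k:]}(j)=\sigma(k+j)$; the rank of $\sigma^{[k:]}$ in $\sigma$ is $k$. The tail order function $\prec^W$ on a set $W$ of lists has $\tau\prec^W_\sigma\rho$ iff $\tau,\rho,\sigma\in W$, $\tau$ and $\rho$ are tails of $\sigma$, and the rank of $\tau$ in $\sigma$ is less than the rank of $\rho$ in $\sigma$. A list frame is an order frame $\langle W,\prec^W\rangle$ where $W$ is a set of lists containing every non-empty tail of each of its members. A list model is an order model based on a list frame. -}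

module Defs where

open import Data.Bool using (Bool; true; not) renaming (_∧_ to _&&_)
open import Data.List using (List; drop; length)
open import Data.List.Properties using (length-drop)
open import Data.Nat using (ℕ; zero; suc; _∸_; _≤_; _<_; z≤n; s≤s)
open import Data.Nat.Induction using (<-wellFounded)
open import Data.Nat.Properties
  using (m∸[m∸n]≡n; <-cmp; <-trans; <-irrefl; <-asym)
open import Data.Product using (∃; ∃-syntax; _×_; _,_; proj₁; proj₂)
open import Data.Refinement using (Refinement; _,_; value; value-injective)
open import Data.Irrelevant using ([_])
open import Data.Sum using (_⊎_; inj₁; inj₂)
open import Function using (_∘_)
open import Induction.WellFounded using (WellFounded; module Subrelation)
open import Level using (0ℓ)
open import Relation.Binary using (Rel; Transitive; Tri; tri<; tri≈; tri>)
open import Relation.Binary.Construct.On using () renaming (wellFounded to on-wellFounded)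
open import Relation.Binary.PropositionalEquality
  using (_≡_; refl; sym; trans; cong; subst; subst₂)
open import Relation.Unary using (Pred; _∈_; _∉_; _∩_; _∪_; ∁; ｛_｝; Empty)

infix  30 ∼_ □_ ◇_
infix  25 _>_
infixr 22 _∧_
infixr 21 _∨_
infix  20 _⟶_ _⟷_

data Formula : Set where
  atom : ℕ → Formula
  ∼_   : Formula → Formula
  _∧_  : Formula → Formula → Formula
  _>_  : Formula → Formula → Formula

_∨_ _⟶_ _⟷_ : Formula → Formula → Formula
p ∨ q = ∼ (∼ p ∧ ∼ q)
p ⟶ q = ∼ (p ∧ ∼ q)
p ⟷ q = (p ⟶ q) ∧ (q ⟶ p)

□_ ◇_ : Formula → Formula
□ p = ∼ p > p
◇ p = ∼ (□ (∼ p))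

data PropFormula : Set where
  var : ℕ → PropFormula
  neg : PropFormula → PropFormula
  and : PropFormula → PropFormula → PropFormula

eval : (ℕ → Bool) → PropFormula → Bool
eval v (var k)   = v k
eval v (neg φ)   = not (eval v φ)
eval v (and φ ψ) = eval v φ && eval v ψ

Tautology : Pred PropFormula 0ℓ
Tautology φ = ∀ v → eval v φ ≡ true

substitute : (ℕ → Formula) → PropFormula → Formula
substitute s (var k)   = s k
substitute s (neg φ)   = ∼ substitute s φ
substitute s (and φ ψ) = substitute s φ ∧ substitute s ψ

-- The theorems of classical propositional logic are taken to be the two-valued
-- tautologies; pc contains all their substitution instances.
data C2Axiom : Pred Formula 0ℓ where
  pc          : ∀ φ → Tautology φ → ∀ s → C2Axiom (substitute s φ)
  identity    : ∀ p → C2Axiom (p > p)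
  reciprocity : ∀ p q r → C2Axiom ((p > q) ∧ (q > p) ∧ (p > r) ⟶ (q > r))
  mp          : ∀ p q → C2Axiom ((p > q) ⟶ (p ⟶ q))
  cem         : ∀ p q → C2Axiom ((p > q) ∨ (p > ∼ q))

data FSAxiom : Pred Formula 0ℓ where
  flattening    : ∀ p q r →
    FSAxiom ((p > ((p ∧ q) > r)) ⟷ ((p ∧ q) > r))
  sequentiality : ∀ p q r →
    FSAxiom (□ (p ⟶ (∼ p > r)) ∧ □ (q ⟶ (∼ q > r))
             ⟶ ((p ∨ q) ⟶ (∼ (p ∨ q) > r)))

data McKinseyAxiom : Pred Formula 0ℓ where
  mckinsey : ∀ p → McKinseyAxiom (□ (◇ p) ⟶ ◇ (□ p))

data Closure (Γ : Pred Formula 0ℓ) : Pred Formula 0ℓ where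
  axiom      : ∀ {p} → p ∈ Γ → Closure Γ p
  detachment : ∀ {p q} → Closure Γ (p ⟶ q) → Closure Γ p → Closure Γ q
  normality  : ∀ {p q r} s → Closure Γ (p ∧ q ⟶ r) →
               Closure Γ ((s > p) ∧ (s > q) ⟶ (s > r))

-- Adding a schema to a logic L: the least set containing L and every instance
-- of the schema that is closed under detachment and normality.
infixl 5 _plus_

_plus_ : Pred Formula 0ℓ → Pred Formula 0ℓ → Pred Formula 0ℓ
L plus Ax = Closure (L ∪ Ax)

C2 C2-FS C2-FSM : Pred Formula 0ℓ
C2     = Closure C2Axiom
C2-FS  = C2 plus FSAxiom
C2-FSM = C2-FS plus McKinseyAxiom

infix 4 ⊢-C2-FSM_

⊢-C2-FSM_ : Pred Formula 0ℓ
⊢-C2-FSM p = p ∈ C2-FSM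

-- Minimal elements are expressed by WellFounded (accessibility), which
-- classically says that every non-empty subset has a least element.
record IsStrictWellOrderOn {A : Set} (D : Pred A 0ℓ) (_≺_ : Rel A 0ℓ) : Set where
  field
    within      : ∀ {x y} → x ≺ y → x ∈ D × y ∈ D
    transitive  : Transitive _≺_
    compare     : ∀ {x y} → x ∈ D → y ∈ D → Tri (x ≺ y) (x ≡ y) (y ≺ x)
    wellFounded : WellFounded _≺_

record OrderFrame : Set₁ where
  field
    World       : Set
    inhabitant  : World
    order       : World → Rel World 0ℓ
    wellOrdered : ∀ w → ∃[ D ] IsStrictWellOrderOn D (order w)
    centered    : ∀ {w x y} → order w x y → w ≡ x ⊎ order w w x

  R : World → Pred World 0ℓ
  R w = ｛ w ｝ ∪ order w w

record OrderModel : Set₁ where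
  field
    frame : OrderFrame
  open OrderFrame frame public
  field
    V : ℕ → World → Bool

  ⟦_⟧ : Formula → Pred World 0ℓ
  ⟦ atom k ⟧ w = V k w ≡ true
  ⟦ ∼ p ⟧      = ∁ ⟦ p ⟧
  ⟦ p ∧ q ⟧    = ⟦ p ⟧ ∩ ⟦ q ⟧
  ⟦ p > q ⟧ w  =
    Empty (R w ∩ ⟦ p ⟧) ⊎
    (∃[ y ] (y ∈ R w ∩ ⟦ p ⟧ ∩ ⟦ q ⟧ × (∀ x → order w x y → x ∉ ⟦ p ⟧)))

  TrueAt : World → Formula → Set
  TrueAt w p = w ∈ ⟦ p ⟧

module _ {P : Set} where

  -- The bound excludes the k > length σ for which drop still returns [].
  TailOfRank : ℕ → List P → List P → Set
  TailOfRank k σ τ = k ≤ length σ × τ ≡ drop k σ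

  TailOf : List P → List P → Set
  TailOf σ τ = ∃[ k ] TailOfRank k σ τ

  rank-unique : ∀ {k σ τ} → TailOfRank k σ τ → length σ ∸ length τ ≡ k
  rank-unique {k} {σ} (k≤ , refl) =
    trans (cong (length σ ∸_) (length-drop k σ)) (m∸[m∸n]≡n k≤)

  -- Worlds are lists paired with an irrelevant membership proof, so that
  -- they are equal exactly when the underlying lists are.
  tailOrder : (W : Pred (List P) 0ℓ) → Refinement (List P) W →
              Rel (Refinement (List P) W) 0ℓ
  tailOrder W σ τ ρ =
    ∃[ i ] ∃[ j ] (TailOfRank i (value σ) (value τ) ×
                   TailOfRank j (value σ) (value ρ) × i < j)

  module _ {W : Pred (List P) 0ℓ} (σ : Refinement (List P) W) where

    private
      rank : Refinement (List P) W → ℕ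
      rank τ = length (value σ) ∸ length (value τ)

      tailOrder⇒< : ∀ τ ρ → tailOrder W σ τ ρ → rank τ < rank ρ
      tailOrder⇒< _ _ (i , j , ti , tj , i<j) =
        subst₂ _<_ (sym (rank-unique ti)) (sym (rank-unique tj)) i<j

    tailOrder-isStrictWellOrder :
      IsStrictWellOrderOn (TailOf (value σ) ∘ value) (tailOrder W σ)
    tailOrder-isStrictWellOrder = record
      { within      = λ (i , j , ti , tj , _) → (i , ti) , (j , tj)
      ; transitive  = λ { (i , j , ti , tj , i<j) (j′ , k , tj′ , tk , j′<k) →
          i , k , ti , tk ,
          <-trans i<j (subst (_< k) (trans (sym (rank-unique tj′)) (rank-unique tj)) j′<k) }
      ; compare     = cmp
      ; wellFounded = Subrelation.wellFounded (λ {τ} {ρ} → tailOrder⇒< τ ρ)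
                        (on-wellFounded rank <-wellFounded)
      }
      where
      cmp : ∀ {x y} → TailOf (value σ) (value x) → TailOf (value σ) (value y) →
            Tri (tailOrder W σ x y) (x ≡ y) (tailOrder W σ y x)
      cmp {x} {y} (i , ti) (j , tj) with <-cmp i j
      ... | tri< i<j _ _ = tri< x≺y (λ x≡y → <-irrefl (cong rank x≡y) (tailOrder⇒< x y x≺y))
                                    (λ y≺x → <-asym (tailOrder⇒< x y x≺y) (tailOrder⇒< y x y≺x))
        where x≺y = i , j , ti , tj , i<j
      ... | tri> _ _ j<i = tri> (λ x≺y → <-asym (tailOrder⇒< x y x≺y) (tailOrder⇒< y x y≺x))
                                (λ x≡y → <-irrefl (cong rank (sym x≡y)) (tailOrder⇒< y x y≺x)) y≺x
        where y≺x = j , i , tj , ti , j<i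
      ... | tri≈ _ refl _ =
        tri≈ (λ x≺y → <-irrefl same-rank (tailOrder⇒< x y x≺y))
             (value-injective same-list)
             (λ y≺x → <-irrefl (sym same-rank) (tailOrder⇒< y x y≺x))
        where
        same-list = trans (proj₂ ti) (sym (proj₂ tj))
        same-rank = cong (λ τ → length (value σ) ∸ length τ) same-list

    tailOrder-centered : ∀ {x y} → tailOrder W σ x y → σ ≡ x ⊎ tailOrder W σ σ x
    tailOrder-centered (zero  , _ , (_ , x≡σ) , _) = inj₁ (value-injective (sym x≡σ))
    tailOrder-centered (suc i , _ , ti , _)        =
      inj₂ (0 , suc i , (z≤n , refl) , ti , s≤s z≤n)

record ListFrame : Set₁ where
  field
    P           : Set
    inhabitant  : P
    W           : Pred (List P) 0ℓ
    nonEmpty    : ∃[ σ ] σ ∈ W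
    tail-closed : ∀ {σ} → σ ∈ W → ∀ k → k < length σ → drop k σ ∈ W

  orderFrame : OrderFrame
  orderFrame = record
    { World       = Refinement (List P) W
    ; inhabitant  = proj₁ nonEmpty , [ proj₂ nonEmpty ]
    ; order       = tailOrder W
    ; wellOrdered = λ σ → _ , tailOrder-isStrictWellOrder σ
    ; centered    = λ {σ} {τ} {ρ} → tailOrder-centered σ {τ} {ρ}
    }

record ListModel : Set₁ where
  field
    listFrame : ListFrame
  open ListFrame listFrame public using (orderFrame)
  field
    valuation : ℕ → OrderFrame.World orderFrame → Bool

  orderModel : OrderModel
  orderModel = record { frame = orderFrame ; V = valuation }

  open OrderModel orderModel public using (World; TrueAt)

{-# OPTIONS --safe #-}

-- In a list model p > q holds at x iff q holds at the first p-world on the chain x, tail x, …,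
-- which makes every axiom valid by induction along the chain.
--
-- For completeness, take the finitely many complete descriptions α of the subformulas of p,
-- draw an edge from α to β when α ∧ ∼ □ α ∧ (∼ α > β) is consistent, and call α terminal when
-- α ∧ □ α is consistent.  The finite paths ending in a terminal description form a list model
-- in which a subformula is true at a path iff it is provable from the head of the path.
-- Let φ be the disjunction of the descriptions that start no such path.  Sequentiality yields
-- φ → □φ, since no edge leaves φ.  No disjunct β of φ is terminal, so ◇∼β is a theorem, hence
-- by McKinsey so is ◇□∼β, and therefore ◇□∼φ.  So φ is refutable, and p is provable as soon as
-- it follows from every description that starts a path.
module Submission where

open import Defs
open import Axiom.ExcludedMiddle using (ExcludedMiddle)
open import Data.Bool using (Bool; true; false; not) renaming (_∧_ to _&&_)
open import Data.Empty using (⊥-elim)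
open import Data.Irrelevant using () renaming ([_] to irr)
open import Data.List using (List; []; _∷_; [_]; _++_; map; foldr; filter; drop; length)
open import Data.List.Membership.Propositional using (_∈_; find; lose)
open import Data.List.Membership.Propositional.Properties
  using (∈-++⁺ˡ; ∈-++⁺ʳ; ∈-++⁻; ∈-map⁻; ∈-filter⁺; ∈-filter⁻)
open import Data.List.Properties using (∷-injectiveʳ)
open import Data.List.Relation.Binary.Subset.Propositional using (_⊆_)
open import Data.List.Relation.Unary.All using (All; []; _∷_)
open import Data.List.Relation.Unary.Any as Any using (Any; here; there)
open import Data.List.Relation.Unary.Any.Properties using (++⁺ˡ; ++⁺ʳ; map⁺)
open import Data.Nat using (ℕ; zero; suc; _<_; z≤n; s≤s)
open import Data.Nat.Properties using (n∸n≡0)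
open import Data.Product using (∃; _×_; _,_; proj₁; proj₂)
open import Data.Refinement using (_,_; value; value-injective)
open import Data.Sum using (_⊎_; inj₁; inj₂; [_,_]′)
open import Function using (_∘_; id)
open import Function.Bundles using (_⇔_; mk⇔; Equivalence)
open import Level using (0ℓ)
open import Relation.Binary.Construct.Closure.ReflexiveTransitive using (Star; ε; _◅_)
open import Relation.Binary.PropositionalEquality using (_≡_; refl; sym; trans; cong; cong₂; subst)
open import Relation.Nullary using (¬_; yes; no; contradiction)
open import Relation.Nullary.Decidable using (decidable-stable; does; recompute)
open import Relation.Unary using (Pred; _∩_)

infix 4 ⊢_

⊢_ : Pred Formula 0ℓ
⊢_ = C2-FSM

-- Classical propositional consequence

truth : (Formula → Bool) → Formula → Bool
truth v (atom k) = v (atom k)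
truth v (∼ p)    = not (truth v p)
truth v (p ∧ q)  = truth v p && truth v q
truth v (p > q)  = v (p > q)

infix 4 _⊨_

-- A record, because the bare equation would reduce and `p` could not be inferred from it.
record _⊨_ (v : Formula → Bool) (p : Formula) : Set where
  constructor holds
  field true≡ : truth v p ≡ true

module _ {v : Formula → Bool} where

  ⊨-dec : ∀ p → v ⊨ p ⊎ v ⊨ ∼ p
  ⊨-dec p with truth v p in eq
  ... | true  = inj₁ (holds eq)
  ... | false = inj₂ (holds (cong not eq))

  ∼-elim : ∀ {p} → v ⊨ ∼ p → ¬ v ⊨ p
  ∼-elim {p} (holds np) (holds h) with truth v p
  ∼-elim (holds ()) (holds refl) | true

  ∼-intro : ∀ {p} → ¬ v ⊨ p → v ⊨ ∼ p
  ∼-intro {p} f = [ ⊥-elim ∘ f , id ]′ (⊨-dec p)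

  by-contradiction : ∀ {p} → ¬ v ⊨ ∼ p → v ⊨ p
  by-contradiction {p} f = [ id , ⊥-elim ∘ f ]′ (⊨-dec p)

  ∧-intro : ∀ {p q} → v ⊨ p → v ⊨ q → v ⊨ p ∧ q
  ∧-intro (holds a) (holds b) = holds (cong₂ _&&_ a b)

  ∧-elim : ∀ {p q} → v ⊨ p ∧ q → v ⊨ p × v ⊨ q
  ∧-elim {p} {q} (holds h) with truth v p in a | truth v q in b
  ... | true | true = holds a , holds b

  ⟶-intro : ∀ {p q} → (v ⊨ p → v ⊨ q) → v ⊨ p ⟶ q
  ⟶-intro f = ∼-intro λ h → let a , b = ∧-elim h in ∼-elim b (f a)

  ⟶-elim : ∀ {p q} → v ⊨ p ⟶ q → v ⊨ p → v ⊨ q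
  ⟶-elim f a = by-contradiction λ b → ∼-elim f (∧-intro a b)

  ∨-introˡ : ∀ {p q} → v ⊨ p → v ⊨ p ∨ q
  ∨-introˡ a = ∼-intro λ h → ∼-elim (proj₁ (∧-elim h)) a

  ∨-introʳ : ∀ {p q} → v ⊨ q → v ⊨ p ∨ q
  ∨-introʳ b = ∼-intro λ h → ∼-elim (proj₂ (∧-elim h)) b

  ∨-elim : ∀ {p q} → v ⊨ p ∨ q → v ⊨ p ⊎ v ⊨ q
  ∨-elim {p} h with ⊨-dec p
  ... | inj₁ a = inj₁ a
  ... | inj₂ a = inj₂ (by-contradiction λ b → ∼-elim h (∧-intro a b))

  ∼∨-intro : ∀ {p q} → v ⊨ ∼ p ∧ ∼ q → v ⊨ ∼ (p ∨ q)
  ∼∨-intro h = ∼-intro ([ ∼-elim (proj₁ (∧-elim h)) , ∼-elim (proj₂ (∧-elim h)) ]′ ∘ ∨-elim)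

  explosion : ∀ {p q} → v ⊨ p ∧ ∼ p → v ⊨ q
  explosion h = ⊥-elim (∼-elim (proj₂ (∧-elim h)) (proj₁ (∧-elim h)))

  curry-⊨ : ∀ Γ {p} → (All (v ⊨_) Γ → v ⊨ p) → v ⊨ foldr _⟶_ p Γ
  curry-⊨ []      f = f []
  curry-⊨ (_ ∷ Γ) f = ⟶-intro λ a → curry-⊨ Γ (f ∘ (a ∷_))

-- From propositional consequence to derivability

module Derivations (em : ExcludedMiddle 0ℓ) where

  index : List Formula → Formula → ℕ
  index []      p = 0
  index (q ∷ L) p with em {p ≡ q}
  ... | yes _ = 0
  ... | no  _ = suc (index L p)

  nth : List Formula → ℕ → Formula
  -- An arbitrary default: `nth-index` speaks only of members of the list.
  nth []      _       = atom 0
  nth (q ∷ L) zero    = q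
  nth (q ∷ L) (suc n) = nth L n

  nth-index : ∀ {L p} → p ∈ L → nth L (index L p) ≡ p
  nth-index {q ∷ L} {p} p∈L with em {p ≡ q} | p∈L
  ... | yes refl | _          = refl
  ... | no p≢q   | here p≡q   = contradiction p≡q p≢q
  ... | no _     | there p∈L′ = nth-index p∈L′

  -- The maximal non-Boolean subformulas, which play the role of propositional variables.
  units : Formula → List Formula
  units (atom k) = [ atom k ]
  units (∼ p)    = units p
  units (p ∧ q)  = units p ++ units q
  units (p > q)  = [ p > q ]

  skeleton : List Formula → Formula → PropFormula
  skeleton L (atom k) = var (index L (atom k))
  skeleton L (∼ p)    = neg (skeleton L p)
  skeleton L (p ∧ q)  = and (skeleton L p) (skeleton L q)
  skeleton L (p > q)  = var (index L (p > q))

  eval-skeleton : ∀ L v p → eval v (skeleton L p) ≡ truth (v ∘ index L) p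
  eval-skeleton L v (atom k) = refl
  eval-skeleton L v (∼ p)    = cong not (eval-skeleton L v p)
  eval-skeleton L v (p ∧ q)  = cong₂ _&&_ (eval-skeleton L v p) (eval-skeleton L v q)
  eval-skeleton L v (p > q)  = refl

  substitute-skeleton : ∀ {L} p → units p ⊆ L → substitute (nth L) (skeleton L p) ≡ p
  substitute-skeleton (atom k) ⊆L = nth-index (⊆L (here refl))
  substitute-skeleton (∼ p)    ⊆L = cong ∼_ (substitute-skeleton p ⊆L)
  substitute-skeleton (p ∧ q)  ⊆L =
    cong₂ _∧_ (substitute-skeleton p (⊆L ∘ ∈-++⁺ˡ)) (substitute-skeleton q (⊆L ∘ ∈-++⁺ʳ (units p)))
  substitute-skeleton (p > q)  ⊆L = nth-index (⊆L (here refl))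

  C2-axiom : ∀ {p} → C2Axiom p → ⊢ p
  C2-axiom a = axiom (inj₁ (axiom (inj₁ (axiom a))))

  FS-axiom : ∀ {p} → FSAxiom p → ⊢ p
  FS-axiom a = axiom (inj₁ (axiom (inj₂ a)))

  -- `p` is a substitution instance of its skeleton, and a valuation of the variables pulls back
  -- along `index L` to one of formulas, so the skeleton is a tautology.
  tautology : ∀ {p} → (∀ {v} → v ⊨ p) → ⊢ p
  tautology {p} f =
    subst ⊢_ (substitute-skeleton p id)
      (C2-axiom (pc (skeleton L p) (λ v → trans (eval-skeleton L v p) (_⊨_.true≡ f)) (nth L)))
    where L = units p

  consequence : ∀ {Γ p} → All ⊢_ Γ → (∀ {v} → All (v ⊨_) Γ → v ⊨ p) → ⊢ p
  consequence {Γ} ts f = detach ts (tautology (curry-⊨ Γ f))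
    where
    detach : ∀ {Γ p} → All ⊢_ Γ → ⊢ foldr _⟶_ p Γ → ⊢ p
    detach []       d = d
    detach (t ∷ ts) d = detach ts (detachment d t)

  ⟶-trans : ∀ {p q r} → ⊢ p ⟶ q → ⊢ q ⟶ r → ⊢ p ⟶ r
  ⟶-trans d e = consequence (d ∷ e ∷ []) λ { (d ∷ e ∷ []) → ⟶-intro (⟶-elim e ∘ ⟶-elim d) }

  -- Conditionals and necessity

  -- Normality asks for two conditionals; `s > s` from Identity serves as both.
  >-necessitation : ∀ {s p} → ⊢ p → ⊢ s > p
  >-necessitation {s} d = consequence
    (normality s (consequence (d ∷ []) λ { (d ∷ []) → ⟶-intro λ _ → d })
      ∷ C2-axiom (identity s) ∷ [])
    λ { (n ∷ i ∷ []) → ⟶-elim n (∧-intro i i) }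

  >-mono : ∀ {s p q} → ⊢ p ⟶ q → ⊢ (s > p) ⟶ (s > q)
  >-mono {s} d = consequence
    (normality s (consequence (d ∷ []) λ { (d ∷ []) → ⟶-intro (⟶-elim d ∘ proj₁ ∘ ∧-elim) }) ∷ [])
    λ { (n ∷ []) → ⟶-intro λ h → ⟶-elim n (∧-intro h h) }

  ⊢⟶⇒> : ∀ {p q} → ⊢ p ⟶ q → ⊢ p > q
  ⊢⟶⇒> {p} d = detachment (>-mono d) (C2-axiom (identity p))

  >-congˡ : ∀ {p q r} → ⊢ p ⟶ q → ⊢ q ⟶ p → ⊢ (p > r) ⟶ (q > r)
  >-congˡ {p} {q} {r} d e = consequence
    (⊢⟶⇒> d ∷ ⊢⟶⇒> e ∷ C2-axiom (reciprocity p q r) ∷ [])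
    λ { (a ∷ b ∷ c ∷ []) → ⟶-intro λ h → ⟶-elim c (∧-intro a (∧-intro b h)) }

  ⊢∼∼⟶ : ∀ {p} → ⊢ ∼ (∼ p) ⟶ p
  ⊢∼∼⟶ = tautology (⟶-intro λ h → by-contradiction (∼-elim h))

  □-T : ∀ {p} → ⊢ □ p ⟶ p
  □-T {p} = consequence (C2-axiom (mp (∼ p) p) ∷ [])
    λ { (m ∷ []) → ⟶-intro λ b → by-contradiction λ n → ∼-elim n (⟶-elim (⟶-elim m b) n) }

  -- `□ p` is `∼ p > p`; normality combines it with `∼ p > ∼ p`.
  □-explosion : ∀ {p q} → ⊢ □ p ⟶ (∼ p > q)
  □-explosion {p} = consequence
    (C2-axiom (identity (∼ p))
      ∷ normality (∼ p) (tautology (⟶-intro explosion))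
      ∷ [])
    λ { (i ∷ n ∷ []) → ⟶-intro λ b → ⟶-elim n (∧-intro b i) }

  -- If `s > p` fails, CEM gives `s > ∼ p`, while `□-explosion` gives `∼ p > s`; Reciprocity then
  -- carries `∼ p > p` over to `s > p`.
  □⟶> : ∀ {p s} → ⊢ □ p ⟶ (s > p)
  □⟶> {p} {s} = consequence
    (C2-axiom (cem s p) ∷ □-explosion {p} {s} ∷ C2-axiom (reciprocity (∼ p) s p) ∷ [])
    λ { (c ∷ e ∷ r ∷ []) → ⟶-intro λ b →
          [ id , (λ n → ⟶-elim r (∧-intro (⟶-elim e b) (∧-intro n b))) ]′ (∨-elim c) }

  □-necessitation : ∀ {p} → ⊢ p → ⊢ □ p
  □-necessitation = >-necessitation

  □-mono : ∀ {p q} → ⊢ p ⟶ q → ⊢ □ p ⟶ □ q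
  □-mono d = ⟶-trans □⟶> (>-mono d)

  □-mono₂ : ∀ {p q r} → ⊢ p ∧ q ⟶ r → ⊢ □ p ∧ □ q ⟶ □ r
  □-mono₂ {p} {q} {r} d = consequence
    (□⟶> {p} {∼ r} ∷ □⟶> {q} {∼ r} ∷ normality (∼ r) d ∷ [])
    λ { (a ∷ b ∷ n ∷ []) → ⟶-intro λ h →
          ⟶-elim n (∧-intro (⟶-elim a (proj₁ (∧-elim h))) (⟶-elim b (proj₂ (∧-elim h)))) }

  -- When `p` entails `s` it is equivalent to `s ∧ p`, so this is Flattening up to a change of
  -- antecedent.
  flatten : ∀ {s p q} → ⊢ p ⟶ s → ⊢ (s > (p > q)) ⟷ (p > q)
  flatten {s} {p} {q} d = consequence
    (FS-axiom (flattening s p q)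
      ∷ >-congˡ p⟶ ⟶p ∷ >-congˡ ⟶p p⟶ ∷ >-mono (>-congˡ p⟶ ⟶p) ∷ >-mono (>-congˡ ⟶p p⟶) ∷ [])
    λ { (f ∷ a ∷ b ∷ c ∷ e ∷ []) → let f₁ , f₂ = ∧-elim f in
          ∧-intro (⟶-intro (⟶-elim b ∘ ⟶-elim f₁ ∘ ⟶-elim c))
                  (⟶-intro (⟶-elim e ∘ ⟶-elim f₂ ∘ ⟶-elim a)) }
    where
    p⟶ : ⊢ p ⟶ s ∧ p
    p⟶ = consequence (d ∷ []) λ { (d ∷ []) → ⟶-intro λ h → ∧-intro (⟶-elim d h) h }
    ⟶p : ⊢ s ∧ p ⟶ p
    ⟶p = tautology (⟶-intro (proj₂ ∘ ∧-elim))

  -- `□ (□ p)` unfolds to `∼ (□ p) > (∼ p > p)`, and `∼ p` entails `∼ (□ p)` by `□-T`, so `flatten`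
  -- applies.
  □-4 : ∀ {p} → ⊢ □ p ⟶ □ (□ p)
  □-4 {p} = consequence
    (flatten (consequence (□-T {p} ∷ []) λ { (t ∷ []) →
        ⟶-intro λ n → ∼-intro (∼-elim n ∘ ⟶-elim t) }) ∷ [])
    λ { (f ∷ []) → proj₂ (∧-elim f) }

  -- Assume `□ (∼ (□ (p ∧ q)))`. Together with `□ p`, which persists by `□-4`, it yields
  -- `□ (∼ (□ q))`, against `e`. So it entails `∼ (□ p)`, and by `□-4` even `□ (∼ (□ p))`, against
  -- `d`.
  ⊢◇□-∧ : ∀ {p q} → ⊢ ◇ (□ p) → ⊢ ◇ (□ q) → ⊢ ◇ (□ (p ∧ q))
  ⊢◇□-∧ {p} {q} d e = consequence (d ∷ ⟶-trans □-4 (□-mono avoid) ∷ [])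
    λ { (d ∷ a ∷ []) → ∼-intro λ h → ∼-elim d (⟶-elim a h) }
    where
    meet : ⊢ ∼ (□ (p ∧ q)) ∧ □ p ⟶ ∼ (□ q)
    meet = consequence (□-mono₂ {p} {q} (tautology (⟶-intro id)) ∷ [])
      λ { (m ∷ []) → ⟶-intro λ h → ∼-intro λ b →
            ∼-elim (proj₁ (∧-elim h)) (⟶-elim m (∧-intro (proj₂ (∧-elim h)) b)) }
    avoid : ⊢ □ (∼ (□ (p ∧ q))) ⟶ ∼ (□ p)
    avoid = consequence (e ∷ □-mono₂ meet ∷ □-4 {p} ∷ [])
      λ { (e ∷ m ∷ f ∷ []) → ⟶-intro λ h → ∼-intro λ b →
            ∼-elim e (⟶-elim m (∧-intro h (⟶-elim f b))) }

  -- Finite disjunctions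

  ⊥′ : Formula
  ⊥′ = atom 0 ∧ ∼ atom 0

  ⊨∼⊥′ : ∀ {v} → v ⊨ ∼ ⊥′
  ⊨∼⊥′ = ∼-intro λ h → ∼-elim (proj₂ (∧-elim h)) (proj₁ (∧-elim h))

  ⋁ : List Formula → Formula
  ⋁ = foldr _∨_ ⊥′

  ⋁-intro : ∀ {v ps} → Any (v ⊨_) ps → v ⊨ ⋁ ps
  ⋁-intro (here h)  = ∨-introˡ h
  ⋁-intro (there a) = ∨-introʳ (⋁-intro a)

  -- The consequent `r` stays fixed in the induction, and both premises are theorems, so they may be
  -- boxed as Sequentiality requires.
  ⋁-sequentiality : ∀ {r} ps → (∀ {p} → p ∈ ps → ⊢ p ⟶ (∼ p > r)) → ⊢ ⋁ ps ⟶ (∼ (⋁ ps) > r)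
  ⋁-sequentiality []       f = tautology (⟶-intro (⊥-elim ∘ ∼-elim ⊨∼⊥′))
  ⋁-sequentiality {r} (p ∷ ps) f = consequence
    (□-necessitation (f (here refl)) ∷ □-necessitation (⋁-sequentiality ps (f ∘ there))
      ∷ FS-axiom (sequentiality p (⋁ ps) r) ∷ [])
    λ { (a ∷ b ∷ s ∷ []) → ⟶-elim s (∧-intro a b) }

  >∼⋁ : ∀ {p s} qs → (∀ {q} → q ∈ qs → ⊢ p ⟶ (s > ∼ q)) → ⊢ p ⟶ (s > ∼ (⋁ qs))
  >∼⋁ []       f = consequence (>-necessitation (tautology ⊨∼⊥′) ∷ []) λ { (d ∷ []) → ⟶-intro λ _ → d }
  >∼⋁ {s = s} (q ∷ qs) f = consequence
    (f (here refl) ∷ >∼⋁ qs (f ∘ there) ∷ normality s (tautology (⟶-intro ∼∨-intro)) ∷ [])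
    λ { (a ∷ b ∷ n ∷ []) → ⟶-intro λ h → ⟶-elim n (∧-intro (⟶-elim a h) (⟶-elim b h)) }

  ⊢◇□∼⋁ : ∀ ps → (∀ {p} → p ∈ ps → ⊢ ◇ (□ (∼ p))) → ⊢ ◇ (□ (∼ (⋁ ps)))
  ⊢◇□∼⋁ []       f = consequence
    (□-T {∼ (□ (∼ ⊥′))} ∷ □-necessitation (tautology ⊨∼⊥′) ∷ [])
    λ { (t ∷ b ∷ []) → ∼-intro λ h → ∼-elim (⟶-elim t h) b }
  ⊢◇□∼⋁ (p ∷ ps) f = ◇□-mono (tautology (⟶-intro ∼∨-intro))
    (⊢◇□-∧ (f (here refl)) (⊢◇□∼⋁ ps (f ∘ there)))
    where
    ◇□-mono : ∀ {p q} → ⊢ p ⟶ q → ⊢ ◇ (□ p) → ⊢ ◇ (□ q)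
    ◇□-mono d e = consequence
      (e ∷ □-mono (consequence (□-mono d ∷ []) λ { (m ∷ []) →
         ⟶-intro λ n → ∼-intro (∼-elim n ∘ ⟶-elim m) }) ∷ [])
      λ { (e ∷ m ∷ []) → ∼-intro (∼-elim e ∘ ⟶-elim m) }

-- Truth in list models

module Semantics (em : ExcludedMiddle 0ℓ) (M : ListModel) where
  open ListModel M using (World; listFrame; orderModel)
  open ListFrame listFrame using (W; tail-closed)
  open OrderModel orderModel using (⟦_⟧; R; V)

  data Next (x y : World) : Set where
    next : ∀ {a} → value x ≡ a ∷ value y → Next x y

  Next-deterministic : ∀ {x y z} → Next x y → Next x z → y ≡ z
  Next-deterministic (next e) (next f) = value-injective (∷-injectiveʳ (trans (sym e) f))

  -- Inductive form of the minimal `Q`-world in the truth clause of `>`, so that proofs can recurse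
  -- along the chain.
  data First (Q : Pred World 0ℓ) : World → World → Set where
    here  : ∀ {x} → Q x → First Q x x
    there : ∀ {x y z} → ¬ Q x → Next x y → First Q y z → First Q x z

  First-deterministic : ∀ {Q x y z} → First Q x y → First Q x z → y ≡ z
  First-deterministic (here _)       (here _)       = refl
  First-deterministic (here h)       (there ¬h _ _) = contradiction h ¬h
  First-deterministic (there ¬h _ _) (here h)       = contradiction h ¬h
  First-deterministic {Q} (there _ n f) (there _ m g) =
    First-deterministic f (subst (λ x → First Q x _) (sym (Next-deterministic n m)) g)

  First-satisfies : ∀ {Q x y} → First Q x y → Q y
  First-satisfies (here h)      = h
  First-satisfies (there _ _ f) = First-satisfies f

  Reach : World → World → Set
  Reach = Star Next

  tail⇒Reach : ∀ j {x y} → TailOfRank j (value x) (value y) → Reach x y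
  tail⇒Reach zero (_ , e) = subst (Reach _) (value-injective (sym e)) ε
  -- Here the tail is the empty list, which `tail-closed` does not supply; it is a world because `y`
  -- is one.
  tail⇒Reach (suc j) {x = (a ∷ [] , _)} {y} (s≤s z≤n , e) =
    next (cong (a ∷_) (sym e)) ◅ ε
  tail⇒Reach (suc j) {x = (a ∷ b ∷ s , irr σ)} (s≤s j≤ , e) =
    _◅_ {j = (b ∷ s , irr (tail-closed σ 1 (s≤s (s≤s z≤n))))} (next refl) (tail⇒Reach j (j≤ , e))

  R⇒Reach : ∀ {x y} → R x y → Reach x y
  R⇒Reach (inj₁ refl)                    = ε
  R⇒Reach (inj₂ (_ , j , _ , ty , _)) = tail⇒Reach j ty

  -- `x` has rank 0 in itself, and no rank is smaller.
  order-irreflexive : ∀ x y → ¬ tailOrder W x y x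
  order-irreflexive x y (i , j , _ , tj , i<j)
    with trans (sym (n∸n≡0 (length (value x)))) (rank-unique tj)
  order-irreflexive x y (_ , _ , _ , _ , ()) | refl

  order-lift : ∀ {x x′} y z → Next x x′ → tailOrder W x′ y z → tailOrder W x y z
  order-lift {(_ , _)} y z (next refl) (i , j , (i≤ , ei) , (j≤ , ej) , i<j) =
    suc i , suc j , (s≤s i≤ , ei) , (s≤s j≤ , ej) , s≤s i<j

  order-lower : ∀ {x x′} y z → Next x x′ → tailOrder W x y z → x ≡ y ⊎ tailOrder W x′ y z
  order-lower y z n (zero , _ , (_ , e) , _) = inj₁ (value-injective (sym e))
  order-lower {(_ , _)} y z (next refl) (suc i , suc j , (s≤s i≤ , ei) , (s≤s j≤ , ej) , s≤s i<j) =
    inj₂ (i , j , (i≤ , ei) , (j≤ , ej) , i<j)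

  R-lift : ∀ {x x′ y} → Next x x′ → R x′ y → tailOrder W x x y
  R-lift {(_ , _)} (next refl) (inj₁ refl) = 0 , 1 , (z≤n , refl) , (s≤s z≤n , refl) , s≤s z≤n
  R-lift {(_ , _)} (next refl) (inj₂ (_ , j , _ , (j≤ , e) , _)) =
    0 , suc j , (z≤n , refl) , (s≤s j≤ , e) , s≤s z≤n

  First⇒R : ∀ {Q x y} → First Q x y → R x y
  First⇒R (here _)      = inj₁ refl
  First⇒R (there _ n f) = inj₂ (R-lift n (First⇒R f))

  First⇒minimal : ∀ {Q x y} → First Q x y → ∀ z → tailOrder W x z y → ¬ Q z
  First⇒minimal {x = x} (here _) z o = contradiction o (order-irreflexive x z)
  First⇒minimal {y = y} (there ¬h n f) z o with order-lower z y n o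
  ... | inj₁ refl = ¬h
  ... | inj₂ o′   = First⇒minimal f z o′

  Reach⇒R : ∀ {x y} → Reach x y → R x y
  Reach⇒R ε       = inj₁ refl
  Reach⇒R (n ◅ r) = inj₂ (R-lift n (Reach⇒R r))

  minimal⇒First : ∀ {Q x y} → Reach x y → Q y → (∀ z → tailOrder W x z y → ¬ Q z) → First Q x y
  minimal⇒First ε       h m = here h
  minimal⇒First {y = y} (n ◅ r) h m =
    there (m _ (R-lift n (Reach⇒R r))) n (minimal⇒First r h λ z o → m z (order-lift z y n o))

  First-exists : ∀ {Q x y} → Reach x y → Q y → ∃ (First Q x)
  First-exists ε h = _ , here h
  First-exists {Q} {x} (n ◅ r) h with em {Q x}
  ... | yes h′ = _ , here h′
  ... | no ¬h  = let z , f = First-exists r h in z , there ¬h n f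

  -- Together with `>-intro` this trades the order for first worlds on the chain; the axioms and the
  -- canonical model are treated through these two alone.
  >-elim : ∀ p q {x y} → ⟦ p > q ⟧ x → First ⟦ p ⟧ x y → ⟦ q ⟧ y
  >-elim p q (inj₁ none) f = ⊥-elim (none _ (First⇒R f , First-satisfies f))
  >-elim p q (inj₂ (_ , (r , hp , hq) , m)) f =
    subst ⟦ q ⟧ (First-deterministic (minimal⇒First (R⇒Reach r) hp m) f) hq

  >-intro : ∀ p q {x} → (∀ {y} → First ⟦ p ⟧ x y → ⟦ q ⟧ y) → ⟦ p > q ⟧ x
  >-intro p q {x} g with em {∃ (First ⟦ p ⟧ x)}
  ... | yes (y , f) = inj₂ (y , (First⇒R f , First-satisfies f , g f) , First⇒minimal f)
  ... | no none     = inj₁ λ y (r , h) → none (First-exists (R⇒Reach r) h)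

  -- Validity of the axioms along a chain

  material : {A B : Set} → ¬ (A × ¬ B) → A → B
  material f a = decidable-stable em λ ¬b → f (a , ¬b)

  □-here : ∀ p {x} → ⟦ □ p ⟧ x → ⟦ p ⟧ x
  □-here p b = decidable-stable em λ ¬h → ¬h (>-elim (∼ p) p b (here ¬h))

  □-next : ∀ p {x y} → ⟦ □ p ⟧ x → Next x y → ⟦ □ p ⟧ y
  □-next p b n = >-intro (∼ p) p λ f → >-elim (∼ p) p b (there (λ ¬h → ¬h (□-here p b)) n f)

  □-reach : ∀ p {x y} → ⟦ □ p ⟧ x → Reach x y → ⟦ p ⟧ y
  □-reach p b ε       = □-here p b
  □-reach p b (n ◅ r) = □-reach p (□-next p b n) r

  -- Lists are finite, so every chain ends; the validity of McKinsey rests on this.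
  last-exists : ∀ x → ∃ λ z → Reach x z × (∀ y → ¬ Next z y)
  last-exists x = go (value x) refl
    where
    go : ∀ s {x} → value x ≡ s → ∃ λ z → Reach x z × (∀ y → ¬ Next z y)
    go s {x} e with em {∃ (Next x)}
    go s       e    | no none           = _ , ε , λ y n → none (y , n)
    go []      refl | yes (_ , next ())
    go (_ ∷ s) e    | yes (y , next e′) =
      let z , r , l = go s (∷-injectiveʳ (trans (sym e′) e)) in z , _◅_ {j = y} (next e′) r , l

  □-last : ∀ p {x} → (∀ y → ¬ Next x y) → ⟦ p ⟧ x → ⟦ □ p ⟧ x
  □-last p {x} l h = >-intro (∼ p) p λ { (here ¬h) → contradiction h ¬h ; (there _ n _) → ⊥-elim (l _ n) }

  -- A world satisfying one of `p`, `q` is first for it and hence satisfies the other; where both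
  -- fail, the two conditionals pass to the next world.
  reciprocity-sound : ∀ p q {x y} → ⟦ p > q ⟧ x → ⟦ q > p ⟧ x → First ⟦ q ⟧ x y → First ⟦ p ⟧ x y
  reciprocity-sound p q a b (here h) = here (>-elim q p b (here h))
  reciprocity-sound p q a b (there ¬q n f) = there ¬p n
    (reciprocity-sound p q
      (>-intro p q λ g → >-elim p q a (there ¬p n g))
      (>-intro q p λ g → >-elim q p b (there ¬q n g)) f)
    where ¬p = λ h → ¬q (>-elim p q a (here h))

  -- No world before the first `P`-world lies in `P ∩ Q`. This and `First-split` give the two
  -- directions of Flattening.
  First-skip : ∀ {P} Q {x y z} → First P x y → First (P ∩ Q) y z → First (P ∩ Q) x z
  First-skip Q (here _)       g = g
  First-skip Q (there ¬h n f) g = there (¬h ∘ proj₁) n (First-skip Q f g)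

  First-split : ∀ P Q {x z} → First (P ∩ Q) x z → ∃ λ y → First P x y × First (P ∩ Q) y z
  First-split P Q (here h) = _ , here (proj₁ h) , here h
  First-split P Q {x} (there ¬h n f) with em {P x}
  ... | yes h = x , here h , there ¬h n f
  ... | no ¬p = let y , g , f′ = First-split P Q f in y , there ¬p n g , f′

  -- The world just before the first failure of p ∨ q satisfies p or q, and the failure is
  -- then also the first failure of that disjunct.
  sequentiality-sound : ∀ p q r {x y} →
    ⟦ □ (p ⟶ (∼ p > r)) ⟧ x → ⟦ □ (q ⟶ (∼ q > r)) ⟧ x →
    ⟦ p ∨ q ⟧ x → First ⟦ ∼ (p ∨ q) ⟧ x y → ⟦ r ⟧ y
  sequentiality-sound p q r a b h (here ¬h) = contradiction h ¬h
  sequentiality-sound p q r {x} a b h (there _ n (here ¬h)) with em {⟦ p ⟧ x}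
  ... | yes hp = >-elim (∼ p) r (material (□-here (p ⟶ (∼ p > r)) a) hp)
                   (there (λ ¬p → ¬p hp) n (here λ hp′ → ¬h λ (¬p , _) → ¬p hp′))
  ... | no ¬p  = >-elim (∼ q) r (material (□-here (q ⟶ (∼ q > r)) b) hq)
                   (there (λ ¬q → ¬q hq) n (here λ hq′ → ¬h λ (_ , ¬q) → ¬q hq′))
    where hq = decidable-stable em λ ¬q → h (¬p , ¬q)
  sequentiality-sound p q r a b h (there _ n f@(there ¬¬h _ _)) =
    sequentiality-sound p q r (□-next (p ⟶ (∼ p > r)) a n) (□-next (q ⟶ (∼ q > r)) b n)
      (decidable-stable em ¬¬h) f

  -- At the last world truth implies necessity by `□-last`: if `p` holds there, so does `□ p`,
  -- against `d`; if not, so does `□ (∼ p)`, against `b`.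
  mckinsey-sound : ∀ p {x} → ⟦ □ (◇ p) ⟧ x → ⟦ ◇ (□ p) ⟧ x
  mckinsey-sound p {x} b d =
    let z , r , l = last-exists x in
    □-reach (◇ p) b r (□-last (∼ p) l λ h → □-reach (∼ (□ p)) d r (□-last p l h))

  -- An equivalence, since the case of `neg` uses the opposite direction.
  eval-sound : ∀ s φ x → eval (λ k → does (em {⟦ s k ⟧ x})) φ ≡ true ⇔ ⟦ substitute s φ ⟧ x
  eval-sound s (var k) x with em {⟦ s k ⟧ x}
  ... | yes h = mk⇔ (λ _ → h) (λ _ → refl)
  ... | no ¬h = mk⇔ (λ ()) (λ h → contradiction h ¬h)
  eval-sound s (neg φ) x
    with eval (λ k → does (em {⟦ s k ⟧ x})) φ | eval-sound s φ x
  ... | true  | e = mk⇔ (λ ()) (λ ¬h → contradiction (Equivalence.to e refl) ¬h)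
  ... | false | e = mk⇔ (λ _ h → contradiction (Equivalence.from e h) (λ ())) (λ _ → refl)
  eval-sound s (and φ ψ) x
    with eval (λ k → does (em {⟦ s k ⟧ x})) φ | eval-sound s φ x
       | eval (λ k → does (em {⟦ s k ⟧ x})) ψ | eval-sound s ψ x
  ... | true  | e | true  | f = mk⇔ (λ _ → Equivalence.to e refl , Equivalence.to f refl) (λ _ → refl)
  ... | true  | e | false | f = mk⇔ (λ ()) (Equivalence.from f ∘ proj₂)
  ... | false | e | _     | f = mk⇔ (λ ()) (Equivalence.from e ∘ proj₁)

  Valid : Pred Formula 0ℓ
  Valid p = ∀ x → ⟦ p ⟧ x

  C2-sound : ∀ {p} → C2Axiom p → Valid p
  C2-sound (pc φ t s) x = Equivalence.to (eval-sound s φ x) (t _)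
  C2-sound (identity p) x = >-intro p p First-satisfies
  C2-sound (reciprocity p q r) x ((a , b , c) , ¬d) =
    ¬d (>-intro q r λ f → >-elim p r c (reciprocity-sound p q a b f))
  C2-sound (mp p q) x (a , ¬i) = ¬i λ (h , ¬q) → ¬q (>-elim p q a (here h))
  C2-sound (cem p q) x (¬a , ¬b) = ¬b (>-intro p (∼ q) λ f h →
    ¬a (>-intro p q λ g → subst ⟦ q ⟧ (First-deterministic f g) h))

  FS-sound : ∀ {p} → FSAxiom p → Valid p
  FS-sound (flattening p q r) x =
    (λ (a , ¬b) → ¬b (>-intro (p ∧ q) r λ f →
      let _ , g , f′ = First-split ⟦ p ⟧ ⟦ q ⟧ f in
      >-elim (p ∧ q) r (>-elim p ((p ∧ q) > r) a g) f′)) ,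
    (λ (a , ¬b) → ¬b (>-intro p ((p ∧ q) > r) λ f →
      >-intro (p ∧ q) r λ g → >-elim (p ∧ q) r a (First-skip ⟦ q ⟧ f g)))
  FS-sound (sequentiality p q r) x ((a , b) , ¬c) =
    ¬c λ (h , ¬d) → ¬d (>-intro (∼ (p ∨ q)) r (sequentiality-sound p q r a b h))

  McKinsey-sound : ∀ {p} → McKinseyAxiom p → Valid p
  McKinsey-sound (mckinsey p) x (b , ¬d) = ¬d (mckinsey-sound p b)

  Closure-sound : ∀ {Γ} → (∀ {p} → Γ p → Valid p) → ∀ {p} → Closure Γ p → Valid p
  Closure-sound s (axiom a)        x = s a x
  Closure-sound s (detachment d e) x = material (Closure-sound s d x) (Closure-sound s e x)
  Closure-sound {Γ} s (normality {p} {q} {r} t d) x ((a , b) , ¬c) =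
    ¬c (>-intro t r λ {y} f → material (Closure-sound s d y) (>-elim t p a f , >-elim t q b f))

  sound : ∀ {p} → ⊢ p → Valid p
  sound = Closure-sound
    [ Closure-sound [ Closure-sound C2-sound , FS-sound ]′ , McKinsey-sound ]′

-- The canonical model of paths of descriptions

module Completeness (em : ExcludedMiddle 0ℓ) where
  open Derivations em

  -- Descriptions of the subformulas

  subformulas : Formula → List Formula
  subformulas (atom k) = [ atom k ]
  subformulas (∼ p)    = (∼ p) ∷ subformulas p
  subformulas (p ∧ q)  = (p ∧ q) ∷ subformulas p ++ subformulas q
  subformulas (p > q)  = (p > q) ∷ subformulas p ++ subformulas q

  self : ∀ p → p ∈ subformulas p
  self (atom k) = here refl
  self (∼ p)    = here refl
  self (p ∧ q)  = here refl
  self (p > q)  = here refl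

  descriptions : List Formula → List Formula
  -- `∼ ⊥′` stands for the empty conjunction.
  descriptions []      = [ ∼ ⊥′ ]
  descriptions (p ∷ Φ) = map (p ∧_) (descriptions Φ) ++ map (∼ p ∧_) (descriptions Φ)

  descriptions-cover : ∀ Φ {v} → Any (v ⊨_) (descriptions Φ)
  descriptions-cover []      = here ⊨∼⊥′
  descriptions-cover (p ∷ Φ) with ⊨-dec p
  ... | inj₁ h = ++⁺ˡ (map⁺ (Any.map (∧-intro h) (descriptions-cover Φ)))
  ... | inj₂ h = ++⁺ʳ _ (map⁺ (Any.map (∧-intro h) (descriptions-cover Φ)))

  Decides : Formula → Formula → Set
  Decides α q = ⊢ α ⟶ q ⊎ ⊢ α ⟶ ∼ q

  ∧-Decides : ∀ {p α q} → Decides α q → Decides (p ∧ α) q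
  ∧-Decides = [ inj₁ ∘ ⟶-trans right , inj₂ ∘ ⟶-trans right ]′
    where right = tautology (⟶-intro (proj₂ ∘ ∧-elim))

  descriptions-decide : ∀ {Φ α q} → α ∈ descriptions Φ → q ∈ Φ → Decides α q
  descriptions-decide {p ∷ Φ} α∈ q∈ with ∈-++⁻ (map (p ∧_) (descriptions Φ)) α∈
  descriptions-decide α∈ q∈ | inj₁ α∈₁ with ∈-map⁻ _ α∈₁ | q∈
  ... | _ , _ , refl    | here refl = inj₁ (tautology (⟶-intro (proj₁ ∘ ∧-elim)))
  ... | _ , α∈₂ , refl | there q∈′ = ∧-Decides (descriptions-decide α∈₂ q∈′)
  descriptions-decide α∈ q∈ | inj₂ α∈₁ with ∈-map⁻ _ α∈₁ | q∈
  ... | _ , _ , refl    | here refl = inj₂ (tautology (⟶-intro (proj₁ ∘ ∧-elim)))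
  ... | _ , α∈₂ , refl | there q∈′ = ∧-Decides (descriptions-decide α∈₂ q∈′)

  -- Consistent paths

  Consistent : Pred Formula 0ℓ
  Consistent p = ¬ ⊢ ∼ p

  -- The conjunct ∼ (□ α) excludes the case in which ∼ α > β holds vacuously.
  Edge : Formula → Formula → Formula
  Edge α β = (α ∧ ∼ (□ α)) ∧ (∼ α > β)

  -- On such a path every conditional p > q is passed on unchanged while p is false and is
  -- vacuously true at an end where p is false, so provability from the head behaves like truth.
  data Path (A : List Formula) : Pred (List Formula) 0ℓ where
    last : ∀ {α} → α ∈ A → Consistent (α ∧ □ α) → Path A [ α ]
    step : ∀ {α β σ} → α ∈ A → Consistent (Edge α β) → Path A (β ∷ σ) → Path A (α ∷ β ∷ σ)

  Path-head : ∀ {A α σ} → Path A (α ∷ σ) → α ∈ A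
  Path-head (last α∈ _)   = α∈
  Path-head (step α∈ _ _) = α∈

  Path-consistent : ∀ {A α σ} → Path A (α ∷ σ) → Consistent α
  Path-consistent (last _ c) d =
    c (consequence (d ∷ []) λ { (d ∷ []) → ∼-intro (∼-elim d ∘ proj₁ ∘ ∧-elim) })
  Path-consistent (step _ c _) d =
    c (consequence (d ∷ []) λ { (d ∷ []) → ∼-intro (∼-elim d ∘ proj₁ ∘ ∧-elim ∘ proj₁ ∘ ∧-elim) })

  Path-drop : ∀ {A σ} → Path A σ → ∀ k → k < length σ → Path A (drop k σ)
  Path-drop π            zero    _         = π
  Path-drop (last _ _)   (suc k) (s≤s ())
  Path-drop (step _ _ π) (suc k) (s≤s k<) = Path-drop π k k<

  -- Conditionals along a path

  ⊢⟶-contradiction : ∀ {α p} → ⊢ α ⟶ p → ⊢ α ⟶ ∼ p → ⊢ ∼ α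
  ⊢⟶-contradiction d e = consequence (d ∷ e ∷ [])
    λ { (d ∷ e ∷ []) → ∼-intro λ h → ∼-elim (⟶-elim e h) (⟶-elim d h) }

  flatten-∼ : ∀ {α p q} → ⊢ α ⟶ ∼ p → ⊢ (∼ α > (p > q)) ⟷ (p > q)
  flatten-∼ d = flatten (consequence (d ∷ []) λ { (d ∷ []) →
    ⟶-intro λ h → ∼-intro λ a → ∼-elim (⟶-elim d a) h })

  >-at : ∀ {α p q} → ⊢ α ⟶ p → ⊢ α ⟶ (p > q) → ⊢ α ⟶ q
  >-at {α} {p} {q} d e = consequence (d ∷ e ∷ C2-axiom (mp p q) ∷ [])
    λ { (d ∷ e ∷ m ∷ []) → ⟶-intro λ h → ⟶-elim (⟶-elim m (⟶-elim e h)) (⟶-elim d h) }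

  at-> : ∀ {α p q} → ⊢ α ⟶ p → ⊢ α ⟶ q → ⊢ α ⟶ (p > q)
  at-> {α} {p} {q} d e = consequence (d ∷ e ∷ C2-axiom (mp p (∼ q)) ∷ C2-axiom (cem p q) ∷ [])
    λ { (d ∷ e ∷ m ∷ c ∷ []) → ⟶-intro λ h →
          [ id , (λ n → ⊥-elim (∼-elim (⟶-elim (⟶-elim m n) (⟶-elim d h)) (⟶-elim e h))) ]′ (∨-elim c) }

  -- The edge gives `∼ α > β`, hence `∼ α > ∼ r`; with `∼ α > r` this makes `∼ α > α`, which is the
  -- excluded `□ α`.
  Edge-inconsistent : ∀ {α β r} → ⊢ α ⟶ (∼ α > r) → ⊢ β ⟶ ∼ r → ⊢ ∼ (Edge α β)
  Edge-inconsistent {α} d e = consequence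
    (d ∷ >-mono e ∷ normality (∼ α) (tautology (⟶-intro explosion)) ∷ [])
    λ { (d ∷ m ∷ n ∷ []) → ∼-intro λ h →
          let hα , c = ∧-elim h ; a , ¬b = ∧-elim hα in
          ∼-elim ¬b (⟶-elim n (∧-intro (⟶-elim d a) (⟶-elim m c))) }

  -- By `flatten-∼`, `α` proves `∼ α > (p > q)`, so no edge leads to a `β` refuting `p > q`.
  >-forward : ∀ {α β p q} → Consistent (Edge α β) → Decides β (p > q) →
              ⊢ α ⟶ ∼ p → ⊢ α ⟶ (p > q) → ⊢ β ⟶ (p > q)
  >-forward c (inj₁ e) d h = e
  >-forward c (inj₂ e) d h = ⊥-elim (c (Edge-inconsistent
    (consequence (h ∷ flatten-∼ d ∷ []) λ { (h ∷ f ∷ []) →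
       ⟶-intro (⟶-elim (proj₂ (∧-elim f)) ∘ ⟶-elim h) }) e))

  -- The edge turns `β ⟶ (p > q)` into `∼ α > (p > q)`, which flattens to `p > q`; so `α` cannot
  -- refute it.
  >-backward : ∀ {α β p q} → Consistent (Edge α β) → Decides α (p > q) →
               ⊢ α ⟶ ∼ p → ⊢ β ⟶ (p > q) → ⊢ α ⟶ (p > q)
  >-backward c (inj₁ e) d h = e
  >-backward {α} c (inj₂ e) d h = ⊥-elim (c (consequence (e ∷ >-mono h ∷ flatten-∼ d ∷ [])
    λ { (e ∷ m ∷ f ∷ []) → ∼-intro λ k →
          let kα , g = ∧-elim k in
          ∼-elim (⟶-elim e (proj₁ (∧-elim kα))) (⟶-elim (proj₁ (∧-elim f)) (⟶-elim m g)) }))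

  -- `□ α` makes every conditional with antecedent `∼ α` true, in particular `∼ α > (p > q)`, which
  -- flattens to `p > q`.
  >-last : ∀ {α p q} → Consistent (α ∧ □ α) → Decides α (p > q) → ⊢ α ⟶ ∼ p → ⊢ α ⟶ (p > q)
  >-last c (inj₁ e) d = e
  >-last {α} {p} {q} c (inj₂ e) d = ⊥-elim (c (consequence
    (e ∷ □-explosion {α} {p > q} ∷ flatten-∼ d ∷ [])
    λ { (e ∷ x ∷ f ∷ []) → ∼-intro λ k →
          let a , b = ∧-elim k in
          ∼-elim (⟶-elim e a) (⟶-elim (proj₁ (∧-elim f)) (⟶-elim x b)) }))

  -- The truth lemma in the canonical model

  module Canonical (A : List Formula) {σ₀} (π₀ : Path A σ₀) where

    canonicalFrame : ListFrame
    canonicalFrame = record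
      { P           = Formula
      ; inhabitant  = ⊥′
      ; W           = Path A
      ; nonEmpty    = σ₀ , π₀
      ; tail-closed = Path-drop
      }

    head : List Formula → Formula
    head []      = ⊥′
    head (α ∷ _) = α

    canonicalModel : ListModel
    canonicalModel = record
      { listFrame = canonicalFrame
      ; valuation = λ k x → does (em {⊢ head (value x) ⟶ atom k})
      }

    open ListModel canonicalModel using (World; TrueAt; orderModel)
    open OrderModel orderModel using (⟦_⟧)
    open Semantics em canonicalModel

    world : ∀ {σ} → Path A σ → World
    world {σ} π = σ , irr π

    Decided : Pred Formula 0ℓ
    Decided q = ∀ {α} → α ∈ A → Decides α q

    Adequate : Pred Formula 0ℓ
    Adequate q = ∀ {α σ} (π : Path A (α ∷ σ)) → TrueAt (world π) q ⇔ ⊢ α ⟶ q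

    refuted : ∀ {α σ q} → Decided q → Adequate q → (π : Path A (α ∷ σ)) →
              ¬ ⟦ q ⟧ (world π) → ⊢ α ⟶ ∼ q
    refuted d a π ¬h with d (Path-head π)
    ... | inj₁ e = contradiction (Equivalence.from (a π) e) ¬h
    ... | inj₂ e = e

    >-true : ∀ {p q} → Decided p → Decided (p > q) → Adequate p → Adequate q →
             ∀ {α σ y} (π : Path A (α ∷ σ)) → ⊢ α ⟶ (p > q) → First ⟦ p ⟧ (world π) y → ⟦ q ⟧ y
    >-true dp d ap aq π h (here hp) =
      Equivalence.from (aq π) (>-at (Equivalence.to (ap π) hp) h)
    -- The next world would be the empty list, which is no path; `recompute` makes the irrelevant
    -- membership proof available for this refutation.
    >-true dp d ap aq (last _ _) h (there {y = _ , irr π} _ (next refl) _) with recompute em π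
    ... | ()
    >-true dp d ap aq π@(step _ c π′) h (there {y = _ , irr _} ¬p (next refl) f) =
      >-true dp d ap aq π′ (>-forward c (d (Path-head π′)) (refuted dp ap π ¬p) h) f

    true-> : ∀ {p q} → Decided p → Decided (p > q) → Adequate p → Adequate q →
             ∀ {α σ} (π : Path A (α ∷ σ)) →
             (∀ {y} → First ⟦ p ⟧ (world π) y → ⟦ q ⟧ y) → ⊢ α ⟶ (p > q)
    true-> {p} {q} dp d ap aq {α} π g with em {⟦ p ⟧ (world π)}
    ... | yes hp = at-> (Equivalence.to (ap π) hp) (Equivalence.to (aq π) (g (here hp)))
    true-> dp d ap aq π@(last α∈ c) g | no ¬p =
      >-last c (d α∈) (refuted dp ap π ¬p)
    true-> dp d ap aq π@(step α∈ c π′) g | no ¬p =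
      >-backward c (d α∈) (refuted dp ap π ¬p)
        (true-> dp d ap aq π′ λ f → g (there ¬p (next refl) f))

    adequate : ∀ q → (∀ {r} → r ∈ subformulas q → Decided r) → Adequate q
    adequate (atom k) d {α} π with em {⊢ α ⟶ atom k}
    ... | yes h = mk⇔ (λ _ → h) (λ _ → refl)
    ... | no ¬h = mk⇔ (λ ()) (λ h → contradiction h ¬h)
    adequate (∼ q) d {α} π = mk⇔ (refuted dq aq π)
      (λ e h → Path-consistent π (⊢⟶-contradiction (Equivalence.to (aq π) h) e))
      where
      aq : Adequate q
      aq = adequate q (d ∘ there)
      dq : Decided q
      dq = d (there (self q))
    adequate (p ∧ q) d π = mk⇔
      (λ (hp , hq) → consequence (Equivalence.to (ap π) hp ∷ Equivalence.to (aq π) hq ∷ [])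
        λ { (a ∷ b ∷ []) → ⟶-intro λ h → ∧-intro (⟶-elim a h) (⟶-elim b h) })
      (λ e → Equivalence.from (ap π) (⟶-trans e (tautology (⟶-intro (proj₁ ∘ ∧-elim))))
           , Equivalence.from (aq π) (⟶-trans e (tautology (⟶-intro (proj₂ ∘ ∧-elim)))))
      where
      ap : Adequate p
      ap = adequate p (d ∘ there ∘ ∈-++⁺ˡ)
      aq : Adequate q
      aq = adequate q (d ∘ there ∘ ∈-++⁺ʳ (subformulas p))
    adequate (p > q) d π = mk⇔
      (λ h → true-> dp dpq ap aq π (>-elim p q h))
      (λ e → >-intro p q (>-true dp dpq ap aq π e))
      where
      ap : Adequate p
      ap = adequate p (d ∘ there ∘ ∈-++⁺ˡ)
      aq : Adequate q
      aq = adequate q (d ∘ there ∘ ∈-++⁺ʳ (subformulas p))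
      dp : Decided p
      dp = d (there (∈-++⁺ˡ (self p)))
      dpq : Decided (p > q)
      dpq = d (here refl)

  -- Descriptions that start no path

  module _ {A : List Formula} (cover : ∀ {v} → Any (v ⊨_) A) where

    Starts : Pred Formula 0ℓ
    Starts α = ∃ λ σ → Path A (α ∷ σ)

    good bad : List Formula
    good = filter (λ α → em {Starts α}) A
    bad  = filter (λ α → em {¬ Starts α}) A

    good-or-bad : ∀ {v} → v ⊨ ⋁ good ⊎ v ⊨ ⋁ bad
    good-or-bad with find cover
    ... | α , α∈ , h with em {Starts α}
    ...   | yes s = inj₁ (⋁-intro (lose (∈-filter⁺ (λ α → em {Starts α}) α∈ s) h))
    ...   | no ¬s = inj₂ (⋁-intro (lose (∈-filter⁺ (λ α → em {¬ Starts α}) α∈ ¬s) h))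

    -- Otherwise `β` alone would be a path.
    bad-∼□ : ∀ {β} → β ∈ bad → ⊢ β ⟶ ∼ (□ β)
    bad-∼□ {β} β∈ =
      let β∈A , ¬s = ∈-filter⁻ (λ α → em {¬ Starts α}) {xs = A} β∈ in
      consequence (decidable-stable em (λ c → ¬s ([] , last β∈A c)) ∷ [])
        λ { (c ∷ []) → ⟶-intro λ h → ∼-intro λ b → ∼-elim c (∧-intro h b) }

    -- An edge from `β` to `γ` would extend the path from `γ`, so `β` refutes `∼ β > γ`, and CEM
    -- leaves `∼ β > ∼ γ`.
    bad-avoids-good : ∀ {β γ} → β ∈ bad → γ ∈ good → ⊢ β ⟶ (∼ β > ∼ γ)
    bad-avoids-good {β} {γ} β∈ γ∈ =
      let β∈A , ¬s = ∈-filter⁻ (λ α → em {¬ Starts α}) {xs = A} β∈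
          _ , σ , π = ∈-filter⁻ (λ α → em {Starts α}) {xs = A} γ∈ in
      consequence (bad-∼□ β∈ ∷ decidable-stable em (λ c → ¬s (γ ∷ σ , step β∈A c π))
                     ∷ C2-axiom (cem (∼ β) γ) ∷ [])
        λ { (n ∷ e ∷ c ∷ []) → ⟶-intro λ h →
              [ (λ g → ⊥-elim (∼-elim e (∧-intro (∧-intro h (⟶-elim n h)) g))) , id ]′ (∨-elim c) }

    -- `□ (⋁ bad)` has the form `∼ (⋁ bad) > r` with `r` the disjunction itself, so
    -- `⋁-sequentiality` reduces the claim to single disjuncts.
    bad-stays-bad : ⊢ ⋁ bad ⟶ □ (⋁ bad)
    bad-stays-bad = ⋁-sequentiality bad λ β∈ →
      ⟶-trans (>∼⋁ good (bad-avoids-good β∈))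
        (>-mono (tautology (⟶-intro λ n → [ (λ g → ⊥-elim (∼-elim n g)) , id ]′ good-or-bad)))

    bad-left : ∀ {β} → β ∈ bad → ⊢ ◇ (□ (∼ β))
    bad-left {β} β∈ = detachment (axiom (inj₂ (mckinsey (∼ β)))) (□-necessitation
      -- This derives `◇ (∼ β)`: its negation `□ (∼ (∼ β))` gives both `β` and `□ β`.
      (consequence (bad-∼□ β∈ ∷ □-mono (⊢∼∼⟶ {β}) ∷ □-T {∼ (∼ β)} ∷ ⊢∼∼⟶ {β} ∷ [])
        λ { (n ∷ m ∷ t ∷ s ∷ []) → ∼-intro λ h →
              ∼-elim (⟶-elim n (⟶-elim s (⟶-elim t h))) (⟶-elim m h) }))

    bad-inconsistent : ⊢ ∼ (⋁ bad)
    bad-inconsistent = consequence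
      -- `⋁ bad` entails its own box, hence `□ (∼ (□ (∼ (⋁ bad))))`, the negation of the theorem
      -- `◇ (□ (∼ (⋁ bad)))`.
      (bad-stays-bad ∷ ⊢◇□∼⋁ bad bad-left ∷ □-mono ∼□∼ ∷ [])
      λ { (b ∷ d ∷ m ∷ []) → ∼-intro λ h → ∼-elim d (⟶-elim m (⟶-elim b h)) }
      where
      ∼□∼ : ⊢ ⋁ bad ⟶ ∼ (□ (∼ (⋁ bad)))
      ∼□∼ = consequence (□-T {∼ (⋁ bad)} ∷ []) λ { (t ∷ []) →
        ⟶-intro λ h → ∼-intro λ b → ∼-elim (⟶-elim t b) h }

    from-starts : ∀ {p} → (∀ {α} → Starts α → ⊢ α ⟶ p) → ⊢ p
    from-starts {p} f = consequence
      (bad-inconsistent ∷ ⋁⟶ good (f ∘ proj₂ ∘ ∈-filter⁻ (λ α → em {Starts α}) {xs = A}) ∷ [])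
      λ { (b ∷ g ∷ []) → [ ⟶-elim g , ⊥-elim ∘ ∼-elim b ]′ good-or-bad }
      where
      ⋁⟶ : ∀ ps → (∀ {α} → α ∈ ps → ⊢ α ⟶ p) → ⊢ ⋁ ps ⟶ p
      ⋁⟶ []       f = tautology (⟶-intro (⊥-elim ∘ ∼-elim ⊨∼⊥′))
      ⋁⟶ (q ∷ ps) f = consequence (f (here refl) ∷ ⋁⟶ ps (f ∘ there) ∷ [])
        λ { (a ∷ b ∷ []) → ⟶-intro ([ ⟶-elim a , ⟶-elim b ]′ ∘ ∨-elim) }

  complete : ∀ p → (∀ (M : ListModel) w → ListModel.TrueAt M w p) → ⊢ p
  complete p valid = from-starts (descriptions-cover Φ) λ (σ , π) →
    -- The given path witnesses that the canonical frame has a world.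
    let open Canonical (descriptions Φ) π in
    Equivalence.to (adequate p (λ r∈ α∈ → descriptions-decide α∈ r∈) π)
      (valid canonicalModel (world π))
    where Φ = subformulas p

theorem6p4 : ExcludedMiddle 0ℓ →
    ∀ (p : Formula) →
    (⊢-C2-FSM p) ⇔ (∀ (M : ListModel) (w : ListModel.World M) → ListModel.TrueAt M w p)
theorem6p4 em p = mk⇔ (λ d M → Semantics.sound em M d) (Completeness.complete em p)
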